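{- For every $\ell\geq 1$ there is $N\in\mathbb{N}$ such that the following holds for every Cayley graph $G$ with generator set $E$ that is $2$-acyclic and $N$-acyclic. Let $v\neq u$ be two vertices of $G$, let $\gamma\subseteq E$ and $t=\rho(v,\gamma)$. Then $$d_t(v,u)=\ell\quad\Longleftrightarrow\quad d_t([\![v]\!],[\![u]\!])=\ell-1.$$
   Context: A Cayley group is a group $G$ (finite or infinite) with a generating set $E\subseteq G$ of non-trivial involutions ($e\neq 1$, $e^2=1$ for $e\in E$). Its Cayley graph, also denoted $G$, has vertex set $G$ and $e$-labelled edges $\{v,ve\}$ for $v\in G$, $e\in E$. For $\alpha\subseteq E$, $G_\alpha$ is the subgroup generated by $\alpha$, and $[v]_\alpha=vG_\alpha$ is the $\alpha$-coset of $v$. A coset cycle of length $m$ in $G$ is a sequence $((v_i,\alpha_i))_{i\in\mathbb{Z}_m}$ with $v_i\in G$, $\alpha_i\subseteq E$, such that for all $i\in\mathbb{Z}_m$: $v_i^{ -1}v_{i+1}\in G_{\alpha_i}$ and $[v_i]_{\alpha_{i-1}\cap\alpha_i}\cap[v_{i+1}]_{\alpha_i\cap\alpha_{i+1}}=\emptyset$. $G$ is $n$-acyclic if it has no coset cycle of length at most $n$. A coset path of length $\ell\geq1$ from $v_1$ to $v_{\ell+1}$ is a sequence $v_1,\alpha_1,v_2,\dots,\alpha_\ell,v_{\ell+1}$ with $v_i\in G$, $\alpha_i\subseteq E$, $v_i^{ -1}v_{i+1}\in G_{\alpha_i}$ for $1\le i\le\ell$, and $[v_i]_{\alpha_{i-1}\cap\alpha_i}\cap[v_{i+1}]_{\alpha_i\cap\alpha_{i+1}}=\emptyset$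 for all $1\leq i\leq\ell$, where $\alpha_0=\alpha_{\ell+1}=\emptyset$. The dual hypergraph $d(G)$ has as vertex set the disjoint union over all $\alpha\subseteq E$ of the sets $Q_\alpha=\{[v]_\alpha: v\in G\}$, and as hyperedges the sets $[\![v]\!]=\{[v]_\alpha:\alpha\subseteq E\}$ for $v\in G$. For $x\in G$ and $\gamma\subseteq E$ let $\rho(x,\gamma)=\{[x]_\beta:\gamma\subseteq\beta\subseteq E\}$, a set of vertices of $d(G)$. For $t=\rho(v,\gamma)$, a coset path $v_1,\alpha_1,\dots,\alpha_\ell,v_{\ell+1}$ is a non-$t$ coset path if $[v]_\gamma\nsubseteq[v_i]_{\alpha_i}$ for all $1\leq i\leq\ell$. For $v\neq u$, $d_t(v,u)$ is the minimal length of a non-$t$ coset path from $v$ to $u$ ($\infty$ if there is none). The Gaifman graph of a hypergraph $(A,S)$ is the undirected graph on $A$ linking distinct $a,a'$ whenever $a,a'\in s$ for some $s\in S$. For a set $t$ of vertices of $d(G)$, $d(G)\setminus t$ is the induced sub-hypergraph on the vertices outside $t$ (hyperedges $s\setminus t$). For sets $X,Y$ of vertices of $d(G)$, $d_t(X,Y)$ is the graph-theoretic distance between $X\setminus t$ and $Y\setminus t$ in the Gaifman graph of $d(G)\setminus t$, i.e. the minimal length of a path from an element of $X\setminus t$ to an element of $Y\setminus t$ ($0$ if these sets intersect, $\infty$ if there is no such path). -}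

module Defs where

open import Level using (Level; _⊔_; suc)
open import Algebra.Bundles using (Group)
open import Data.Nat as ℕ using (ℕ; NonZero; _≤_)
open import Data.Nat.DivMod using (_mod_)
open import Data.Fin using (Fin; toℕ)
open import Data.Product using (Σ; ∃; ∃-syntax; _×_; _,_; proj₁; proj₂)
open import Relation.Binary using (Rel; Setoid; _Respects_)
open import Relation.Nullary using (¬_)
open import Relation.Unary using (Pred; _∈_; _∉_; _⊆_; _⊈_; _∩_; _≐_; _⊥_; Empty)
import Relation.Binary.Construct.On as On

private
  variable
    a c e i p r s t : Level

-- `n` is the minimum of the set `P` of lengths.  A distance "is k" when k is
-- the minimum of the lengths of connecting paths; distance ∞ corresponds to
-- `P` being empty, in which case `IsMinimum P n` fails for every n.
IsMinimum : Pred ℕ p → Pred ℕ p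
IsMinimum P n = n ∈ P × (∀ m → m ∈ P → n ≤ m)

------------------------------------------------------------------------
-- Hypergraphs

-- Vertices form a setoid; the set of hyperedges is given as a family.
record Hypergraph (a e i s : Level) : Set (suc (a ⊔ e ⊔ i ⊔ s)) where
  field
    vertexSetoid   : Setoid a e
  open Setoid vertexSetoid public using () renaming (Carrier to Vertex; _≈_ to _≈ᵥ_)
  field
    Index          : Set i
    hyperedge      : Index → Pred Vertex s
    hyperedge-resp : ∀ j → hyperedge j Respects _≈ᵥ_

  Gaifman : Rel Vertex (e ⊔ i ⊔ s)
  Gaifman x y = (¬ (x ≈ᵥ y)) × ∃[ j ] (x ∈ hyperedge j × y ∈ hyperedge j)

-- Induced sub-hypergraph on the vertices outside T.
delete : (H : Hypergraph a e i s) → Pred (Hypergraph.Vertex H) t →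
         Hypergraph (a ⊔ t) e i s
delete H T = record
  { vertexSetoid   = On.setoid {B = Σ Vertex (_∉ T)} vertexSetoid proj₁
  ; Index          = Index
  ; hyperedge      = λ j x → proj₁ x ∈ hyperedge j
  ; hyperedge-resp = λ j → hyperedge-resp j
  }
  where open Hypergraph H

data Path {A : Set a} (_~_ : Rel A r) : ℕ → Rel A (a ⊔ r) where
  []  : ∀ {x} → Path _~_ 0 x x
  _∷_ : ∀ {n x y z} → x ~ y → Path _~_ n y z → Path _~_ (ℕ.suc n) x z

module _ (H : Hypergraph a e i s) (T : Pred (Hypergraph.Vertex H) t) where
  private
    H∖T = delete H T
  open Hypergraph H∖T using (Gaifman) renaming (Vertex to Vertex∖T)

  -- Lengths of Gaifman paths in H ∖ T from X ∖ T to Y ∖ T.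
  GaifmanLength : (X Y : Pred (Hypergraph.Vertex H) r) →
                  Pred ℕ (a ⊔ e ⊔ i ⊔ s ⊔ t ⊔ r)
  GaifmanLength X Y n =
    ∃ λ (x : Vertex∖T) → ∃ λ (y : Vertex∖T) →
      proj₁ x ∈ X × proj₁ y ∈ Y × Path Gaifman n x y

  -- d_T(X , Y) = n
  SetDistance : (X Y : Pred (Hypergraph.Vertex H) r) →
                Pred ℕ (a ⊔ e ⊔ i ⊔ s ⊔ t ⊔ r)
  SetDistance X Y = IsMinimum (GaifmanLength X Y)

------------------------------------------------------------------------
-- Cayley groups

-- i + 1 and i - 1 in ℤ_m, represented by Fin m.
next prev : ∀ {m} .{{_ : NonZero m}} → Fin m → Fin m
next {m} j = (toℕ j ℕ.+ 1) mod m
prev {m} j = (toℕ j ℕ.+ (m ℕ.∸ 1)) mod m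

module _ (G : Group c e) where
  open Group G

  data ⟨_⟩ (X : Pred Carrier p) : Pred Carrier (c ⊔ e ⊔ p) where
    gen  : ∀ {g} → g ∈ X → g ∈ ⟨ X ⟩
    unit : ε ∈ ⟨ X ⟩
    mul  : ∀ {g h} → g ∈ ⟨ X ⟩ → h ∈ ⟨ X ⟩ → g ∙ h ∈ ⟨ X ⟩
    inv  : ∀ {g} → g ∈ ⟨ X ⟩ → g ⁻¹ ∈ ⟨ X ⟩
    resp : ⟨ X ⟩ Respects _≈_

record CayleyGroup (c e p : Level) : Set (suc (c ⊔ e ⊔ p)) where
  field
    group       : Group c e
  open Group group public
  field
    E           : Pred Carrier p
    E-resp      : E Respects _≈_
    nontrivial  : ∀ {x} → x ∈ E → ¬ (x ≈ ε)
    involutive  : ∀ {x} → x ∈ E → x ∙ x ≈ ε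
    generating  : ∀ g → g ∈ ⟨_⟩ group E

module Cayley {c e p : Level} (G : CayleyGroup c e p) where
  open CayleyGroup G

  record GeneratorSet : Set (c ⊔ e ⊔ suc p) where
    field
      member : Pred Carrier p
      ⊆E     : member ⊆ E
      closed : member Respects _≈_
  open GeneratorSet public

  infixr 7 _∩ᴱ_
  _∩ᴱ_ : GeneratorSet → GeneratorSet → GeneratorSet
  α ∩ᴱ β = record
    { member = member α ∩ member β
    ; ⊆E     = λ x∈ → ⊆E α (proj₁ x∈)
    ; closed = λ x≈y x∈ → closed α x≈y (proj₁ x∈) , closed β x≈y (proj₂ x∈)
    }

  Subgroup : GeneratorSet → Pred Carrier (c ⊔ e ⊔ p)
  Subgroup α = ⟨_⟩ group (member α)

  [_] : Carrier → GeneratorSet → Pred Carrier (c ⊔ e ⊔ p)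
  [ v ] α = λ w → ∃[ g ] (g ∈ Subgroup α × w ≈ v ∙ g)

  record CosetCycle (m : ℕ) .{{_ : NonZero m}} : Set (c ⊔ e ⊔ suc p) where
    field
      v        : Fin m → Carrier
      α        : Fin m → GeneratorSet
      step     : ∀ j → v j ⁻¹ ∙ v (next j) ∈ Subgroup (α j)
      disjoint : ∀ j → [ v j ] (α (prev j) ∩ᴱ α j)
                     ⊥ [ v (next j) ] (α j ∩ᴱ α (next j))

  Acyclic : ℕ → Set (c ⊔ e ⊔ suc p)
  Acyclic n = ∀ m .{{_ : NonZero m}} → m ≤ n → ¬ CosetCycle m

  -- Only v 1, …, v (ℓ + 1) and α 0, …, α (ℓ + 1) are constrained; the values
  -- of the two functions elsewhere are irrelevant.
  record CosetPath (ℓ : ℕ) (x y : Carrier) : Set (c ⊔ e ⊔ suc p) where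
    field
      positive : 1 ≤ ℓ
      v        : ℕ → Carrier
      α        : ℕ → GeneratorSet
      start    : v 1 ≈ x
      end      : v (ℓ ℕ.+ 1) ≈ y
      α-first  : Empty (member (α 0))
      α-last   : Empty (member (α (ℓ ℕ.+ 1)))
      step     : ∀ j → 1 ≤ j → j ≤ ℓ → v j ⁻¹ ∙ v (j ℕ.+ 1) ∈ Subgroup (α j)
      disjoint : ∀ j → 1 ≤ j → j ≤ ℓ →
                 [ v j ] (α (j ℕ.∸ 1) ∩ᴱ α j)
                 ⊥ [ v (j ℕ.+ 1) ] (α j ∩ᴱ α (j ℕ.+ 1))

  -- Avoiding t = ρ(z , γ).
  NonT : (z : Carrier) (γ : GeneratorSet) →
         ∀ {ℓ x y} → CosetPath ℓ x y → Set (c ⊔ e ⊔ p)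
  NonT z γ {ℓ} P = ∀ j → 1 ≤ j → j ≤ ℓ → [ z ] γ ⊈ [ v j ] (α j)
    where open CosetPath P

  -- d_t(x , y) = ℓ for t = ρ(z , γ).
  CosetDistance : (z : Carrier) (γ : GeneratorSet) (x y : Carrier) →
                  Pred ℕ (c ⊔ e ⊔ suc p)
  CosetDistance z γ x y = IsMinimum (λ ℓ → ∃ λ (P : CosetPath ℓ x y) → NonT z γ P)

  -- The pair (α , v) stands for [v]_α as an element of Q_α; elements of the
  -- disjoint union agree when both the tags α and the cosets agree.
  cosetSetoid : Setoid (c ⊔ e ⊔ suc p) (c ⊔ e ⊔ p)
  cosetSetoid = record
    { Carrier       = GeneratorSet × Carrier
    ; _≈_           = λ (α , v) (β , w) → member α ≐ member β × [ v ] α ≐ [ w ] β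
    ; isEquivalence = record
      { refl  = ((λ z → z) , (λ z → z)) , ((λ z → z) , (λ z → z))
      ; sym   = λ ((f , g) , (h , k)) → (g , f) , (k , h)
      ; trans = λ ((f , g) , (h , k)) ((f′ , g′) , (h′ , k′)) →
          ((λ z → f′ (f z)) , (λ z → g (g′ z))) ,
          ((λ z → h′ (h z)) , (λ z → k (k′ z)))
      }
    }

  private
    module Q = Setoid cosetSetoid

  ⟦_⟧ : Carrier → Pred Q.Carrier (c ⊔ e ⊔ suc p)
  ⟦ v ⟧ = λ q → ∃[ α ] (q Q.≈ (α , v))

  dual : Hypergraph (c ⊔ e ⊔ suc p) (c ⊔ e ⊔ p) c (c ⊔ e ⊔ suc p)
  dual = record
    { vertexSetoid   = cosetSetoid
    ; Index          = Carrier
    ; hyperedge      = ⟦_⟧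
    ; hyperedge-resp = λ v {q} {q′} q≈q′ (α , q≈) →
        α , Q.trans {q′} {q} {α , v} (Q.sym {q} {q′} q≈q′) q≈
    }

  ρ : Carrier → GeneratorSet → Pred Q.Carrier (c ⊔ e ⊔ suc p)
  ρ x γ = λ q → ∃[ β ] (member γ ⊆ member β × q Q.≈ (β , x))

{-# OPTIONS --safe #-}

-- Call a sequence of overlapping cosets a walk when it satisfies every condition of a
-- non-t coset path except disjointness. If disjointness fails at position i, a common
-- element of the two cosets can replace both v_i and v_{i+1}, which removes α_i from the
-- walk; hence a shortest walk is a coset path. Walks of length n + 1 correspond to Gaifman
-- walks of length n in d(G) ∖ t, up to shortening when consecutive cosets coincide.
-- 2-acyclicity is needed only to see that a coset [v]_α ⊇ [v]_γ belongs to ρ(v, γ),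
-- that is, γ ⊆ α. So N = 0 suffices.
module Submission where

open import Defs
open import Level using (Level; _⊔_; suc; Lift; lift; lower)
open import Axiom.ExcludedMiddle using (ExcludedMiddle)
import Algebra.Properties.Group as GroupProperties
open import Data.Empty using (⊥-elim)
open import Data.Fin using (Fin)
open import Data.Nat as ℕ using (ℕ; _≤_; _∸_; z≤n; s≤s; s≤s⁻¹)
open import Data.Nat.Properties
  using (≤-refl; ≤-reflexive; ≤-trans; ≤-antisym; m≤n⇒m≤1+n; m≤m+n; m≤n+m;
         +-comm; +-suc; +-identityʳ)
open import Data.Product using (∃; ∃-syntax; _×_; _,_; proj₁; proj₂)
open import Function.Base using (id; _∘_)
open import Function.Bundles using (_⇔_; mk⇔)
open import Relation.Binary using (Setoid)
open import Relation.Binary.PropositionalEquality as ≡ using (_≡_; subst)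
open import Relation.Nullary using (¬_; Dec; yes; no)
open import Relation.Nullary.Decidable using (map′)
open import Relation.Unary using (Pred; _∈_; _∉_; _⊆_; _⊈_; _⊥_; Empty; _≐_)
open import Relation.Unary.Polymorphic using (∅)
open import Relation.Unary.Polymorphic.Properties using (∅-Empty)
import Relation.Binary.Reasoning.Setoid as ≈-Reasoning

-- Minima of sets of lengths.

module _ {p q} {P : Pred ℕ p} {Q : Pred ℕ q} where

  -- Neither map need preserve lengths. The lower bound on `Q` comes from `Q⇒P`, and it forces the
  -- length that `P⇒Q` makes out of `n` to be `n` itself.
  IsMinimum-transfer : (∀ {n} → n ∈ P → ∃[ m ] (m ≤ n × m ∈ Q)) →
                       (∀ {n} → n ∈ Q → ∃[ m ] (m ≤ n × m ∈ P)) →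
                       IsMinimum P ⊆ IsMinimum Q
  IsMinimum-transfer P⇒Q Q⇒P {n} (n∈P , n-min) = n∈Q , lowerBound
    where
    lowerBound : ∀ m → m ∈ Q → n ≤ m
    lowerBound m m∈Q with k , k≤m , k∈P ← Q⇒P m∈Q = ≤-trans (n-min k k∈P) k≤m

    n∈Q : n ∈ Q
    n∈Q with m , m≤n , m∈Q ← P⇒Q n∈P =
      subst (_∈ Q) (≤-antisym m≤n (lowerBound m m∈Q)) m∈Q

module _ {p} {P : Pred ℕ p} where

  IsMinimum-pred : ∀ {n} → IsMinimum P (ℕ.suc n) → IsMinimum (P ∘ ℕ.suc) n
  IsMinimum-pred (n∈P , n-min) = n∈P , λ m m∈P → s≤s⁻¹ (n-min (ℕ.suc m) m∈P)

  IsMinimum-suc : 0 ∉ P → ∀ {n} → IsMinimum (P ∘ ℕ.suc) n → IsMinimum P (ℕ.suc n)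
  IsMinimum-suc 0∉P (n∈P , n-min) = n∈P , λ where
    0          0∈P → ⊥-elim (0∉P 0∈P)
    (ℕ.suc m)  m∈P → s≤s (n-min m m∈P)

-- Generated subgroups and their cosets.

module CayleyProperties {c e p : Level} (G : CayleyGroup c e p) where
  open CayleyGroup G
  open Cayley G
  open GroupProperties group using (ε⁻¹≈ε; ⁻¹-anti-homo-\\; \\-leftDividesˡ; \\-leftDividesʳ)
  open ≈-Reasoning setoid

  ∅ᴱ : GeneratorSet
  ∅ᴱ = record { member = ∅ ; ⊆E = λ () ; closed = λ _ () }

  _∖ᴱ_ : GeneratorSet → GeneratorSet → GeneratorSet
  α ∖ᴱ β = record
    { member = λ x → x ∈ member α × x ∉ member β
    ; ⊆E     = ⊆E α ∘ proj₁
    ; closed = λ x≈y (x∈α , x∉β) → closed α x≈y x∈α , x∉β ∘ closed β (sym x≈y)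
    }

  ⟨⟩-mono : ∀ {a b} {X : Pred Carrier a} {Y : Pred Carrier b} →
           X ⊆ Y → ⟨_⟩ group X ⊆ ⟨_⟩ group Y
  ⟨⟩-mono X⊆Y (gen g∈)      = gen (X⊆Y g∈)
  ⟨⟩-mono X⊆Y unit          = unit
  ⟨⟩-mono X⊆Y (mul g∈ h∈)   = mul (⟨⟩-mono X⊆Y g∈) (⟨⟩-mono X⊆Y h∈)
  ⟨⟩-mono X⊆Y (inv g∈)      = inv (⟨⟩-mono X⊆Y g∈)
  ⟨⟩-mono X⊆Y (resp g≈h g∈) = resp g≈h (⟨⟩-mono X⊆Y g∈)

  ⟨⟩-trivial : ∀ {a} {X : Pred Carrier a} {g} → Empty X → g ∈ ⟨_⟩ group X → g ≈ ε
  ⟨⟩-trivial X-empty (gen {g} g∈) = ⊥-elim (X-empty g g∈)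
  ⟨⟩-trivial X-empty unit = refl
  ⟨⟩-trivial X-empty (mul g∈ h∈) =
    trans (∙-cong (⟨⟩-trivial X-empty g∈) (⟨⟩-trivial X-empty h∈)) (identityˡ ε)
  ⟨⟩-trivial X-empty (inv g∈) =
    trans (⁻¹-cong (⟨⟩-trivial X-empty g∈)) ε⁻¹≈ε
  ⟨⟩-trivial X-empty (resp g≈h g∈) = trans (sym g≈h) (⟨⟩-trivial X-empty g∈)

  -- x ∼[ α ] y is y ∈ [ x ] α, in the form in which steps of coset paths are given.
  infix 4 _∼[_]_
  _∼[_]_ : Carrier → GeneratorSet → Carrier → Set _
  x ∼[ α ] y = x ⁻¹ ∙ y ∈ Subgroup α

  module _ {α : GeneratorSet} where

    ∼-reflexive : ∀ {x y} → x ≈ y → x ∼[ α ] y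
    ∼-reflexive {x} x≈y = resp (trans (sym (inverseˡ x)) (∙-congˡ x≈y)) unit

    ∼-sym : ∀ {x y} → x ∼[ α ] y → y ∼[ α ] x
    ∼-sym {x} {y} x∼y = resp (⁻¹-anti-homo-\\ x y) (inv x∼y)

    ∼-trans : ∀ {x y z} → x ∼[ α ] y → y ∼[ α ] z → x ∼[ α ] z
    ∼-trans {x} {y} {z} x∼y y∼z = resp (begin
      (x ⁻¹ ∙ y) ∙ (y ⁻¹ ∙ z) ≈⟨ assoc (x ⁻¹) y (y ⁻¹ ∙ z) ⟩
      x ⁻¹ ∙ (y ∙ (y ⁻¹ ∙ z)) ≈⟨ ∙-congˡ (\\-leftDividesˡ y z) ⟩
      x ⁻¹ ∙ z                ∎) (mul x∼y y∼z)

    ∼⇒∈ : ∀ {x y} → x ∼[ α ] y → y ∈ [ x ] α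
    ∼⇒∈ {x} {y} x∼y = x ⁻¹ ∙ y , x∼y , sym (\\-leftDividesˡ x y)

    ∈⇒∼ : ∀ {x y} → y ∈ [ x ] α → x ∼[ α ] y
    ∈⇒∼ {x} (g , g∈ , y≈xg) = resp (sym (trans (∙-congˡ y≈xg) (\\-leftDividesʳ x g))) g∈

    ∼⇒⊆ : ∀ {x y} → x ∼[ α ] y → [ x ] α ⊆ [ y ] α
    ∼⇒⊆ x∼y z∈ = ∼⇒∈ (∼-trans (∼-sym x∼y) (∈⇒∼ z∈))

    ∼⇒≐ : ∀ {x y} → x ∼[ α ] y → [ x ] α ≐ [ y ] α
    ∼⇒≐ x∼y = ∼⇒⊆ x∼y , ∼⇒⊆ (∼-sym x∼y)

  ∼-mono : ∀ {α β x y} → member α ⊆ member β → x ∼[ α ] y → x ∼[ β ] y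
  ∼-mono {α} {β} α⊆β = ⟨⟩-mono α⊆β

  ∼-trivial : ∀ {α x y} → Empty (member α) → x ∼[ α ] y → x ≈ y
  ∼-trivial {α} {x} {y} α-empty x∼y = begin
    x              ≈⟨ identityʳ x ⟨
    x ∙ ε          ≈⟨ ∙-congˡ (⟨⟩-trivial α-empty x∼y) ⟨
    x ∙ (x ⁻¹ ∙ y) ≈⟨ \\-leftDividesˡ x y ⟩
    y              ∎

  -- A generator x ∈ γ ∖ α in ⟨ α ⟩ gives the coset 2-cycle ε, x with labels γ ∖ α and α.
  Subgroup-cancel-⊆ : Acyclic 2 → ∀ {γ α} → (∀ x → Dec (x ∈ member α)) →
                      Subgroup γ ⊆ Subgroup α → member γ ⊆ member α
  Subgroup-cancel-⊆ acyclic {γ} {α} _∈α? γ≤α {x} x∈γ with x ∈α?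
  ... | yes x∈α = x∈α
  ... | no  x∉α = ⊥-elim (acyclic 2 ≤-refl cycle)
    where
    γ∖α : GeneratorSet
    γ∖α = γ ∖ᴱ α

    x≉ε : ¬ x ≈ ε
    x≉ε = nontrivial (⊆E γ x∈γ)

    ε∼x : ∀ {β} → x ∈ Subgroup β → ε ∼[ β ] x
    ε∼x {β} x∈ = ∈⇒∼ {β} (x , x∈ , sym (identityˡ x))

    apart : ∀ {β δ w} → Empty (member β) → Empty (member δ) →
            w ∈ [ ε ] β → w ∉ [ x ] δ
    apart {β} {δ} β-empty δ-empty w∈ w∈′ =
      x≉ε (trans (∼-trivial {δ} δ-empty (∈⇒∼ {δ} w∈′))
                 (sym (∼-trivial {β} β-empty (∈⇒∼ {β} w∈))))

    α∩ : Empty (member (α ∩ᴱ γ∖α))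
    α∩ _ (y∈α , _ , y∉α) = y∉α y∈α

    ∩α : Empty (member (γ∖α ∩ᴱ α))
    ∩α _ ((_ , y∉α) , y∈α) = y∉α y∈α

    cycle : CosetCycle 2
    cycle = record
      { v        = λ { Fin.zero → ε ; (Fin.suc _) → x }
      ; α        = λ { Fin.zero → γ∖α ; (Fin.suc _) → α }
      ; step     = λ where
          Fin.zero           → ε∼x {γ∖α} (gen (x∈γ , x∉α))
          (Fin.suc Fin.zero) → ∼-sym {α} (ε∼x {α} (γ≤α (gen x∈γ)))
      -- Modulo 2 the previous and the next index agree, so both conditions compare the same two
      -- singleton cosets, of `ε` and of `x`.
      ; disjoint = λ where
          Fin.zero           (w∈ , w∈′) → apart {α ∩ᴱ γ∖α} {γ∖α ∩ᴱ α} α∩ ∩α w∈ w∈′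
          (Fin.suc Fin.zero) (w∈ , w∈′) → apart {α ∩ᴱ γ∖α} {γ∖α ∩ᴱ α} α∩ ∩α w∈′ w∈
      }

-- Walks and their shortening.

module Walks {c e p : Level} (em : ExcludedMiddle (c ⊔ e ⊔ suc p)) (G : CayleyGroup c e p)
             (z : CayleyGroup.Carrier G) (γ : Cayley.GeneratorSet G) where
  open CayleyGroup G
  open Cayley G
  open CayleyProperties G

  Link : GeneratorSet → Carrier → Carrier → Set _
  Link α x y = x ∼[ α ] y × [ z ] γ ⊈ [ x ] α

  Link-moveˡ : ∀ {α x x′ y} → x ∼[ α ] x′ → Link α x y → Link α x′ y
  Link-moveˡ {α} x∼x′ (x∼y , avoids) =
    ∼-trans {α} (∼-sym {α} x∼x′) x∼y ,
    λ ⊆[x′] → avoids λ w∈ → ∼⇒⊆ {α} (∼-sym {α} x∼x′) (⊆[x′] w∈)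

  Link-moveʳ : ∀ {α x y y′} → Link α x y → y ∼[ α ] y′ → Link α x y′
  Link-moveʳ {α} (x∼y , avoids) y∼y′ = ∼-trans {α} x∼y y∼y′ , avoids

  data Walk : ℕ → Carrier → Carrier → Set (c ⊔ e ⊔ suc p) where
    stop : ∀ {x y} → x ≈ y → Walk 0 x y
    link : ∀ {n x y w} α → Link α x y → Walk n y w → Walk (ℕ.suc n) x w

  Walk-respˡ : ∀ {n x x′ y} → x ≈ x′ → Walk n x y → Walk n x′ y
  Walk-respˡ x≈x′ (stop x≈y)    = stop (trans (sym x≈x′) x≈y)
  Walk-respˡ x≈x′ (link α l ls) = link α (Link-moveˡ {α} (∼-reflexive {α} x≈x′) l) ls

  -- v_i and α_i of the paper for i ≥ 1, with the extra argument at i = 0.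
  label : ∀ {n x y} → GeneratorSet → Walk n x y → ℕ → GeneratorSet
  label β ls            ℕ.zero    = β
  -- The default past the last link is the empty label that closes a coset path.
  label β (stop _)      (ℕ.suc i) = ∅ᴱ
  label β (link α l ls) (ℕ.suc i) = label α ls i

  node : ∀ {n x y} → Carrier → Walk n x y → ℕ → Carrier
  node a ls                    ℕ.zero    = a
  node a (stop {x} _)          (ℕ.suc i) = x
  node a (link {x = x} α l ls) (ℕ.suc i) = node x ls i

  node-first : ∀ {n x y} a (ls : Walk n x y) → node a ls 1 ≡ x
  node-first a (stop _)     = ≡.refl
  node-first a (link _ _ _) = ≡.refl

  node-last : ∀ {n x y} a (ls : Walk n x y) → node a ls (ℕ.suc n) ≈ y
  node-last a (stop x≈y)    = x≈y
  node-last a (link _ _ ls) = node-last _ ls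

  label-last : ∀ {n x y} β (ls : Walk n x y) → label β ls (ℕ.suc n) ≡ ∅ᴱ
  label-last β (stop _)      = ≡.refl
  label-last β (link _ _ ls) = label-last _ ls

  link-at : ∀ {n x y} a β (ls : Walk n x y) {i} → i ℕ.< n →
            Link (label β ls (ℕ.suc i)) (node a ls (ℕ.suc i)) (node a ls (ℕ.suc (ℕ.suc i)))
  link-at a β (link {x = x} α l ls) {ℕ.zero} _ =
    subst (Link α x) (≡.sym (node-first x ls)) l
  link-at a β (link {x = x} α l ls) {ℕ.suc i} i<n = link-at x α ls (s≤s⁻¹ i<n)

  -- A witness `g` that disjointness fails at position `i + 1`.
  Meets : ∀ {n x y} → Carrier → GeneratorSet → Walk n x y → ℕ → Carrier → Set _
  Meets a β ls i g =
    g ∈ [ node a ls (ℕ.suc i) ] (label β ls i ∩ᴱ label β ls (ℕ.suc i)) ×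
    g ∈ [ node a ls (ℕ.suc (ℕ.suc i)) ] (label β ls (ℕ.suc i) ∩ᴱ label β ls (ℕ.suc (ℕ.suc i)))

  -- The start may move within its β-coset, where β labels the link preceding the walk:
  -- that link then absorbs the change in the induction.
  shorten : ∀ {n x y g} a β (ls : Walk (ℕ.suc n) x y) {i} → i ≤ n → Meets a β ls i g →
            ∃[ x′ ] (x ∼[ β ] x′ × Walk n x′ y)
  -- The label after the last link is empty, so `g` is the endpoint and nothing remains of the walk.
  shorten {g = g} a β (link α l (stop y≈w)) {ℕ.zero} _ (g∈ , g∈′) =
    g , ∼-mono {α = β ∩ᴱ α} {β = β} proj₁ (∈⇒∼ {β ∩ᴱ α} g∈) ,
    stop (trans (sym (∼-trivial {α ∩ᴱ ∅ᴱ} (λ _ → lower ∘ proj₂) (∈⇒∼ {α ∩ᴱ ∅ᴱ} g∈′))) y≈w)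
  -- `g` lies in the `α′`-coset of the next node, so the next link can start at `g`; the link `α` is
  -- dropped.
  shorten {g = g} a β (link α l (link α′ l′ ls)) {ℕ.zero} _ (g∈ , g∈′) =
    g , ∼-mono {α = β ∩ᴱ α} {β = β} proj₁ (∈⇒∼ {β ∩ᴱ α} g∈) ,
    link α′ (Link-moveˡ {α′} (∼-mono {α = α ∩ᴱ α′} {β = α′} proj₂ (∈⇒∼ {α ∩ᴱ α′} g∈′)) l′) ls
  shorten {ℕ.suc n} {x} a β (link α l ls) {ℕ.suc i} i≤n meets
    with y′ , y∼y′ , ls′ ← shorten x α ls (s≤s⁻¹ i≤n) meets =
    x , ∼-reflexive {β} refl , link α (Link-moveʳ {α} l y∼y′) ls′

  -- Coset paths and walks.

  NonTCosetPath : Carrier → Carrier → Pred ℕ _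
  NonTCosetPath x y n = ∃ λ (P : CosetPath n x y) → NonT z γ P

  cosetPath⇒walk : ∀ {n x y} → NonTCosetPath x y n → Walk n x y
  cosetPath⇒walk {n} {x} {y} (P , avoids) = Walk-respˡ start (go n 1 ≤-refl ≡.refl)
    where
    open CosetPath P

    -- The invariant says that `k` links remain from `v j` to `v (n + 1)`.
    go : ∀ k j → 1 ≤ j → j ℕ.+ k ≡ ℕ.suc n → Walk k (v j) y
    go ℕ.zero j _ j≡ = stop (subst (λ i → v i ≈ y)
      (≡.trans (+-comm n 1) (≡.trans (≡.sym j≡) (+-identityʳ j))) end)
    go (ℕ.suc k) j 1≤j j+k≡ =
      link (α j) (step j 1≤j j≤n , avoids j 1≤j j≤n)
        (go k (j ℕ.+ 1) (m≤n+m 1 j) (≡.trans (≡.cong (ℕ._+ k) (+-comm j 1)) 1+j+k≡))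
      where
      1+j+k≡ : ℕ.suc (j ℕ.+ k) ≡ ℕ.suc n
      1+j+k≡ = ≡.trans (≡.sym (+-suc j k)) j+k≡

      j≤n : j ≤ n
      j≤n = ≤-trans (m≤m+n j k) (≤-reflexive (≡.cong ℕ.pred 1+j+k≡))

  -- A failure of disjointness removes exactly one link, so excluding walks with one link less is
  -- enough. With `∅ᴱ` in front, the start moves only within a singleton coset, so the shorter walk
  -- still starts at `x`.
  irreducible⇒cosetPath : ∀ {n x y} → ¬ Walk n x y → Walk (ℕ.suc n) x y →
                          NonTCosetPath x y (ℕ.suc n)
  irreducible⇒cosetPath {n} {x} {y} irreducible ls = record
    { positive = s≤s z≤n
    ; v        = v
    ; α        = α
    ; start    = reflexive (node-first x ls)
    ; end      = subst (λ i → v i ≈ y) (+-comm 1 (ℕ.suc n)) (node-last x ls)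
    ; α-first  = ∅-Empty
    ; α-last   = subst (λ i → Empty (member (α i))) (+-comm 1 (ℕ.suc n))
                   (subst (Empty ∘ member) (≡.sym (label-last ∅ᴱ ls)) ∅-Empty)
    ; step     = λ { (ℕ.suc i) _ i<n →
        subst (λ k → v (ℕ.suc i) ∼[ α (ℕ.suc i) ] v k) (+-comm 1 (ℕ.suc i))
          (proj₁ (link-at x ∅ᴱ ls i<n)) }
    ; disjoint = λ { (ℕ.suc i) _ i<n →
        subst (λ k → [ v (ℕ.suc i) ] (α i ∩ᴱ α (ℕ.suc i)) ⊥ [ v k ] (α (ℕ.suc i) ∩ᴱ α k))
          (+-comm 1 (ℕ.suc i)) (λ meets → reducible (shorten x ∅ᴱ ls (s≤s⁻¹ i<n) meets)) }
    } , λ { (ℕ.suc i) _ i<n → proj₂ (link-at x ∅ᴱ ls i<n) }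
    where
    v : ℕ → Carrier
    v = node x ls

    α : ℕ → GeneratorSet
    α = label ∅ᴱ ls

    reducible : ¬ (∃[ x′ ] (x ∼[ ∅ᴱ ] x′ × Walk n x′ y))
    reducible (x′ , x∼x′ , ls′) =
      irreducible (Walk-respˡ (sym (∼-trivial {∅ᴱ} ∅-Empty x∼x′)) ls′)

  -- Descent on the length: pass to a walk with one link less as long as there is one. Since `x` and
  -- `y` differ, this stops before length 0.
  walk⇒cosetPath : ∀ {n x y} → ¬ x ≈ y → Walk (ℕ.suc n) x y →
                   ∃[ m ] (m ≤ n × NonTCosetPath x y (ℕ.suc m))
  walk⇒cosetPath {n} {x} {y} x≉y ls with em {Walk n x y}
  walk⇒cosetPath x≉y ls | no irreducible = _ , ≤-refl , irreducible⇒cosetPath irreducible ls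
  walk⇒cosetPath x≉y ls | yes (stop x≈y) = ⊥-elim (x≉y x≈y)
  walk⇒cosetPath x≉y ls | yes ls′@(link _ _ _) with m , m≤n , P ← walk⇒cosetPath x≉y ls′ =
    m , m≤n⇒m≤1+n m≤n , P

  -- The dual hypergraph outside `t`.

  private
    module Q = Setoid cosetSetoid

    t : Pred Q.Carrier _
    t = ρ z γ

    module H∖t = Hypergraph (delete dual t)

  DualLength : Carrier → Carrier → Pred ℕ _
  DualLength x y = GaifmanLength dual t ⟦ x ⟧ ⟦ y ⟧

  ∼⇒≈Q : ∀ {α x y} → x ∼[ α ] y → (α , x) Q.≈ (α , y)
  ∼⇒≈Q {α} x∼y = (id , id) , ∼⇒≐ {α} x∼y

  avoids⇒∉t : ∀ {α x} → [ z ] γ ⊈ [ x ] α → (α , x) ∉ t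
  avoids⇒∉t {α} {x} avoids (β , γ⊆β , _ , _ , ⊇) =
    avoids λ w∈ → ⊇ (∼⇒∈ {β} (∼-mono {γ} {β} γ⊆β (∈⇒∼ {γ} w∈)))

  -- Each link becomes the vertex given by its coset, and two consecutive cosets share the hyperedge
  -- of the node between them. Gaifman edges join distinct vertices only, so a repeated coset is
  -- merged.
  walk⇒dual : ∀ {n x y} → Walk (ℕ.suc n) x y → ∃[ m ] (m ≤ n × DualLength x y m)
  walk⇒dual {x = x} (link α (x∼y , avoids) (stop y≈w)) =
    0 , z≤n , q , q , (α , Q.refl {α , x}) ,
    (α , ∼⇒≈Q {α} (∼-trans {α} x∼y (∼-reflexive {α} y≈w))) , []
    where
    q : H∖t.Vertex
    q = (α , x) , avoids⇒∉t {α} avoids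
  walk⇒dual {x = x} (link {y = y} α (x∼y , avoids) ls@(link _ _ _))
    with m , m≤n , q , r , q∈ , r∈ , path ← walk⇒dual ls
    with em {Lift (suc p) ((α , x) Q.≈ proj₁ q)}
  ... | yes (lift x≈q) =
    m , m≤n⇒m≤1+n m≤n , q , r , (α , Q.sym {α , x} {proj₁ q} x≈q) , r∈ , path
  ... | no  x≉q =
    ℕ.suc m , s≤s m≤n ,
    ((α , x) , avoids⇒∉t {α} avoids) , r , (α , Q.refl {α , x}) , r∈ ,
    (x≉q ∘ lift , y , (α , ∼⇒≈Q {α} x∼y) , q∈) ∷ path

  module _ (acyclic : Acyclic 2) where

    -- The coset contains `z`, so it is `[ z ] α`; cancelling `z` leaves an inclusion of subgroups,
    -- which 2-acyclicity turns into one of generating sets.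
    ⊆⇒∈t : ∀ {α x} → [ z ] γ ⊆ [ x ] α → (α , x) ∈ t
    ⊆⇒∈t {α} {x} zγ⊆xα = α , γ⊆α , ∼⇒≈Q {α} x∼z
      where
      x∼z : x ∼[ α ] z
      x∼z = ∈⇒∼ {α} (zγ⊆xα (∼⇒∈ {γ} (∼-reflexive {γ} refl)))

      γ≤α : Subgroup γ ⊆ Subgroup α
      γ≤α {g} g∈ = resp (GroupProperties.\\-leftDividesʳ group z g)
        (∼-trans {α} (∼-sym {α} x∼z) (∈⇒∼ {α} (zγ⊆xα (g , g∈ , refl))))

      γ⊆α : member γ ⊆ member α
      γ⊆α = Subgroup-cancel-⊆ acyclic {γ} {α}
        (λ _ → map′ lower lift (em {Lift (c ⊔ e ⊔ suc p) _})) γ≤α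

    hyperedges⇒link : ∀ {q x y} → q ∉ t → q ∈ ⟦ x ⟧ → q ∈ ⟦ y ⟧ → ∃[ α ] Link α x y
    hyperedges⇒link {q} {x} {y} q∉t (α , q≈x) (β , q≈y) =
      α ,
      ∈⇒∼ {α} (proj₁ (proj₂ q≈x) (proj₂ (proj₂ q≈y) (∼⇒∈ {β} (∼-reflexive {β} refl)))) ,
      λ zγ⊆ → q∉t (let β′ , γ⊆ , x≈z = ⊆⇒∈t {α} zγ⊆ in
        β′ , γ⊆ , Q.trans {q} {α , x} {β′ , z} q≈x x≈z)

    -- Vertices become links and the hyperedges joining them supply the nodes; a path with `n` edges
    -- has `n + 1` vertices.
    dual⇒walk : ∀ {n x y} → DualLength x y n → Walk (ℕ.suc n) x y
    dual⇒walk ((q , q∉t) , _ , q∈x , q∈y , [])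
      with α , l ← hyperedges⇒link {q} q∉t q∈x q∈y = link α l (stop refl)
    dual⇒walk ((q , q∉t) , r , q∈x , r∈y , (_ , j , q∈j , q′∈j) ∷ path)
      with α , l ← hyperedges⇒link {q} q∉t q∈x q∈j =
      link α l (dual⇒walk (_ , r , q′∈j , r∈y , path))

    cosetDistance⇔setDistance : ∀ {n x y} → ¬ x ≈ y →
      CosetDistance z γ x y (ℕ.suc n) ⇔ SetDistance dual t ⟦ x ⟧ ⟦ y ⟧ n
    cosetDistance⇔setDistance {x = x} {y} x≉y = mk⇔
      (IsMinimum-transfer coset⇒dual dual⇒coset ∘ IsMinimum-pred)
      -- Shifting back could miss a minimum at 0; coset paths have positive length.
      (IsMinimum-suc (λ (P , _) → 1≰0 (CosetPath.positive P))
        ∘ IsMinimum-transfer dual⇒coset coset⇒dual)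
      where
      1≰0 : ¬ 1 ≤ 0
      1≰0 ()

      coset⇒dual : ∀ {n} → NonTCosetPath x y (ℕ.suc n) → ∃[ m ] (m ≤ n × DualLength x y m)
      coset⇒dual P = walk⇒dual (cosetPath⇒walk P)

      dual⇒coset : ∀ {n} → DualLength x y n → ∃[ m ] (m ≤ n × NonTCosetPath x y (ℕ.suc m))
      dual⇒coset path = walk⇒cosetPath x≉y (dual⇒walk path)

proposition4p24 : ∀ {c e p : Level} → ExcludedMiddle (c ⊔ e ⊔ suc p) →
    (ℓ : ℕ) → 1 ≤ ℓ →
    ∃ λ (N : ℕ) →
    (G : CayleyGroup c e p) →
    Cayley.Acyclic G 2 → Cayley.Acyclic G N →
    (v u : CayleyGroup.Carrier G) → ¬ (CayleyGroup._≈_ G v u) →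
    (γ : Cayley.GeneratorSet G) →
    Cayley.CosetDistance G v γ v u ℓ
    ⇔ SetDistance (Cayley.dual G) (Cayley.ρ G v γ) (Cayley.⟦_⟧ G v) (Cayley.⟦_⟧ G u) (ℓ ∸ 1)
proposition4p24 em (ℕ.suc n) _ =
  0 , λ G acyclic _ v u v≉u γ → Walks.cosetDistance⇔setDistance em G v γ acyclic v≉u
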